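{- Let $\lambda$ be an infinite regular cardinal. If $2^\lambda=\lambda^+$, then there is a regular ultrafilter on $\lambda$ which is not doubly regular.
   Context: A family of sets is a regular family if finite intersections of members of the family are non-empty but all infinite intersections (i.e. intersections of infinitely many members) are empty. A filter is $\mu$-regular if it contains a regular family of size $\mu$. A filter on $\lambda$, or on a set of cardinality $\lambda$, is called regular if it is $\lambda$-regular. A filter $D$ on a regular cardinal $\lambda$ is called doubly regular if there are pairwise disjoint sets $u_i\subseteq\lambda$, $i<\lambda$, each of cardinality $\lambda$, and regular filters $D_i$ on $u_i$, such that for all $A\subseteq\lambda$: if $A\cap u_i\in D_i$ for all but boundedly many $i<\lambda$, then $A\in D$. -}

module Defs where

open import Level using (Level; _⊔_; suc)
open import Data.Bool.Base using (Bool)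
open import Data.List.Relation.Unary.All using (All)
open import Data.List.Relation.Unary.Enumerates.Setoid using (IsEnumeration)
open import Data.Product.Base using (Σ; ∃-syntax; _×_; proj₁)
open import Data.Sum.Base using (_⊎_)
open import Data.Unit.Polymorphic.Base using (⊤)
open import Function.Bundles using (Injection; Bijection)
open import Induction.WellFounded using (WellFounded)
open import Relation.Binary.Bundles using (Setoid)
open import Relation.Binary.Core using (Rel)
import Relation.Binary.Construct.On as On
open import Relation.Binary.PropositionalEquality using (_≡_; _≢_; setoid; _→-setoid_)
open import Relation.Binary.Structures using (IsStrictTotalOrder)
open import Relation.Nullary.Negation.Core using (¬_)
open import Relation.Unary using (Pred; _∈_; _⊆_; _∩_; _⊥_; ∁; Empty)
open import Relation.Unary.Relation.Binary.Equality using (≐-setoid)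

-- Sizes are compared through setoids, so that two members
-- of a subset agree as soon as the underlying elements do, whatever the
-- proofs of membership.

infix 4 _≈ᶜ_ _≤ᶜ_ _<ᶜ_

_≈ᶜ_ _≤ᶜ_ _<ᶜ_ : ∀ {a ℓ₁ b ℓ₂} → Setoid a ℓ₁ → Setoid b ℓ₂ → Set (a ⊔ ℓ₁ ⊔ b ⊔ ℓ₂)
S ≈ᶜ T = Bijection S T
S ≤ᶜ T = Injection S T
S <ᶜ T = S ≤ᶜ T × ¬ (T ≤ᶜ S)

Finite Infinite : ∀ {a ℓ} → Setoid a ℓ → Set (a ⊔ ℓ)
Finite   S = ∃[ xs ] IsEnumeration S xs
Infinite S = ¬ Finite S

subset : ∀ {a ℓ p} (S : Setoid a ℓ) → Pred (Setoid.Carrier S) p → Setoid (a ⊔ p) ℓ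
subset S P = On.setoid {B = Σ (Setoid.Carrier S) P} S proj₁

⟦_⟧ : ∀ {a p} {X : Set a} → Pred X p → Setoid (a ⊔ p) a
⟦ P ⟧ = subset (setoid _) P

-- A family of subsets is counted up to extensional equality of its members.
⟦_⟧ᶠ : ∀ {ℓ} {X : Set ℓ} → Pred (Pred X ℓ) ℓ → Setoid (suc ℓ) ℓ
⟦ F ⟧ᶠ = subset (≐-setoid _ _) F

-- Ordinals are well-ordered types; an element a stands for the smaller
-- ordinal given by the initial segment below a.

record Ordinal ℓ : Set (suc ℓ) where
  infix 4 _<_
  field
    Carrier            : Set ℓ
    _<_                : Rel Carrier ℓ
    isStrictTotalOrder : IsStrictTotalOrder _≡_ _<_
    wellFounded        : WellFounded _<_

  card : Setoid ℓ ℓ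
  card = setoid Carrier

  segment : Carrier → Setoid ℓ ℓ
  segment a = ⟦ (_< a) ⟧

module _ {ℓ} (Λ : Ordinal ℓ) where
  open Ordinal Λ

  IsCardinal : Set ℓ
  IsCardinal = ∀ a → segment a <ᶜ card

  -- Cofinality equal to Λ: no function from an ordinal a below Λ into Λ
  -- is unbounded.  Such a function is given by a total one, of which only
  -- the values below a are used.
  record IsInfiniteRegularCardinal : Set ℓ where
    field
      isCardinal : IsCardinal
      infinite   : Infinite card
      regular    : ∀ a (f : Carrier → Carrier) → ∃[ b ] (∀ x → x < a → f x < b)

  -- Λ⁺ is the least ordinal of cardinality greater than that of Λ.
  IsSuccessor : Ordinal ℓ → Set ℓ
  IsSuccessor Λ⁺ = card <ᶜ Ordinal.card Λ⁺ × (∀ w → Ordinal.segment Λ⁺ w ≤ᶜ card)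

  2^Λ≡Λ⁺ : Set (suc ℓ)
  2^Λ≡Λ⁺ = ∃[ Λ⁺ ] IsSuccessor Λ⁺ × (Carrier →-setoid Bool) ≈ᶜ Ordinal.card Λ⁺

module _ {ℓ} {X : Set ℓ} where

  record IsRegularFamily (F : Pred (Pred X ℓ) ℓ) : Set (suc ℓ) where
    field
      finite-⋂   : ∀ As → All (_∈ F) As → ∃[ x ] All (x ∈_) As
      infinite-⋂ : ∀ (G : Pred (Pred X ℓ) ℓ) → G ⊆ F → Infinite ⟦ G ⟧ᶠ →
                   Empty (λ x → ∀ A → A ∈ G → x ∈ A)

  -- A (proper) filter on the subset V of X; its members are subsets of V.
  record IsFilter (V : Pred X ℓ) (D : Pred (Pred X ℓ) ℓ) : Set (suc ℓ) where
    field
      members  : ∀ {A} → A ∈ D → A ⊆ V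
      whole    : V ∈ D
      upward   : ∀ {A B} → A ∈ D → A ⊆ B → B ⊆ V → B ∈ D
      ∩-closed : ∀ {A B} → A ∈ D → B ∈ D → (A ∩ B) ∈ D
      proper   : ∀ {A} → A ∈ D → ¬ Empty A

  Regular : ∀ {a b} → Setoid a b → Pred (Pred X ℓ) ℓ → Set (a ⊔ b ⊔ suc ℓ)
  Regular μ D = ∃[ F ] IsRegularFamily F × ⟦ F ⟧ᶠ ≈ᶜ μ × F ⊆ D

module _ {ℓ} (Λ : Ordinal ℓ) where
  open Ordinal Λ

  record IsUltrafilter (D : Pred (Pred Carrier ℓ) ℓ) : Set (suc ℓ) where
    field
      isFilter : IsFilter (λ _ → ⊤) D
      ultra    : ∀ A → A ∈ D ⊎ ∁ A ∈ D

  record DoublyRegular (D : Pred (Pred Carrier ℓ) ℓ) : Set (suc ℓ) where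
    field
      u         : Carrier → Pred Carrier ℓ
      disjoint  : ∀ {i j} → i ≢ j → u i ⊥ u j
      size      : ∀ i → ⟦ u i ⟧ ≈ᶜ card
      Dᵢ        : Carrier → Pred (Pred Carrier ℓ) ℓ
      isFilter  : ∀ i → IsFilter (u i) (Dᵢ i)
      regular   : ∀ i → Regular card (Dᵢ i)
      reflects  : ∀ A → (∃[ b ] (∀ i → b < i → (A ∩ u i) ∈ Dᵢ i)) → A ∈ D

{-# OPTIONS --safe #-}
-- By recursion along Λ⁺ ≈ 2^Λ build sets X_ξ, each meeting the filter base
-- generated by the earlier ones together with the regular family
-- { {x : a ∈ decode x} : a ∈ Λ }, where decode lists every finite subset of Λ.
-- X_ξ decides the ξ-th subset of Λ, and for the disjoint family (u i) coded by
-- that same subset it either misses u i for all large i or meets each u i in at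
-- most one point.  No point lies in all members of a regular family of size Λ,
-- so in each case there are sets in the given filters on u i, for all large i,
-- whose union is disjoint from X_ξ and hence outside the ultrafilter.

module Submission where

open import Defs
open import Level using (Level; suc; Lift; lift; lower)
open import Axiom.ExcludedMiddle using (ExcludedMiddle)
open import Data.Product.Base using (∃-syntax; _×_; ∃; _,_; proj₁; proj₂; map₂)
open import Relation.Nullary.Negation.Core using (¬_)
open import Data.Bool.Base using (Bool; true; false)
open import Data.Empty using (⊥-elim)
open import Data.List.Base using (List; []; _∷_; _++_)
open import Data.List.Properties using (∷-injectiveˡ; ∷-injectiveʳ)
open import Data.List.Membership.Propositional renaming (_∈_ to _∈ˡ_)
open import Data.List.Relation.Unary.All using (All; []; _∷_; reduce)
open import Data.List.Relation.Unary.Any using (Any; here; there)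
import Data.List.Relation.Unary.All as All
import Data.List.Relation.Unary.All.Properties as All
import Data.List.Relation.Unary.Enumerates.Setoid.Properties as Enumerates
open import Data.Product.Relation.Binary.Lex.Strict using (×-Lex; ×-compare; ×-wellFounded)
open import Data.Sum.Base using (_⊎_; inj₁; inj₂; [_,_]′)
import Data.Sum.Base as Sum
open import Data.Unit.Polymorphic.Base using (tt)
open import Function.Base using (_∘_; _on_; case_of_; id)
open import Function.Bundles using (Injection; Bijection; Surjection)
open import Induction.WellFounded using (WellFounded; WfRec; module FixPoint)
  renaming (module All to WF)
open import Relation.Binary.Core using (Rel)
open import Relation.Binary.Definitions using (tri<; tri≈; tri>)
import Relation.Binary.Construct.On as On
open import Relation.Binary.PropositionalEquality
  using (_≡_; _≢_; refl; sym; trans; cong; cong₂; subst)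
open import Relation.Binary.Structures using (IsStrictTotalOrder)
open import Relation.Nullary.Decidable using (Dec; yes; no; does; map′; decidable-stable; dec-true)
open import Relation.Unary using (Pred; _∈_; _⊆_; _≐_; _∩_; _⊥_; ∁; Satisfiable)

-- Least elements of well-orders and transfinite choice.

module Classical {ℓ} (em : ExcludedMiddle (suc ℓ)) where

  decide : (A : Set ℓ) → Dec A
  decide A = map′ lower lift (em {Lift (suc ℓ) A})

  stable : {A : Set ℓ} → ¬ ¬ A → A
  stable = decidable-stable (decide _)

  module WellOrder (V : Ordinal ℓ) where
    open Ordinal V

    Least : Pred Carrier ℓ → Pred Carrier ℓ
    Least P v = P v × (∀ w → w < v → ¬ P w)

    least : (P : Pred Carrier ℓ) → ∃ P → ∃ (Least P)
    least P (v , p) = WF.wfRec wellFounded _ (λ v → P v → ∃ (Least P)) body v p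
      where
      body : ∀ v → WfRec _<_ (λ v → P v → ∃ (Least P)) v → P v → ∃ (Least P)
      body v rec p with decide (∃[ w ] w < v × P w)
      ... | yes (w , w<v , q) = rec w<v q
      ... | no none = v , p , λ w w<v q → none (w , w<v , q)

    least-unique : ∀ {P Q v w} → P ≐ Q → Least P v → Least Q w → v ≡ w
    least-unique {v = v} {w} (P⊆Q , Q⊆P) (p , v-min) (q , w-min)
      with IsStrictTotalOrder.compare isStrictTotalOrder v w
    ... | tri< v<w _ _ = ⊥-elim (w-min v v<w (P⊆Q p))
    ... | tri≈ _ v≡w _ = v≡w
    ... | tri> _ _ w<v = ⊥-elim (v-min w w<v (Q⊆P q))

    -- Total in `P`, with default `v₀`, so that the recursion can be defined before nonemptiness is
    -- known.
    leastOr : Carrier → Pred Carrier ℓ → Carrier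
    leastOr v₀ P with decide (∃ (Least P))
    ... | yes (v , _) = v
    ... | no _ = v₀

    leastOr-∈ : ∀ v₀ P → ∃ P → P (leastOr v₀ P)
    leastOr-∈ v₀ P ∃P with decide (∃ (Least P))
    ... | yes (_ , p , _) = p
    ... | no none = ⊥-elim (none (least P ∃P))

    leastOr-cong : ∀ v₀ {P Q} → P ≐ Q → leastOr v₀ P ≡ leastOr v₀ Q
    leastOr-cong v₀ {P} {Q} P≐Q@(P⊆Q , Q⊆P) with decide (∃ (Least P)) | decide (∃ (Least Q))
    ... | yes (_ , p) | yes (_ , q) = least-unique P≐Q p q
    ... | yes (v , p , _) | no none = ⊥-elim (none (least Q (v , P⊆Q p)))
    ... | no none | yes (v , q , _) = ⊥-elim (none (least P (v , Q⊆P q)))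
    ... | no _ | no _ = refl

  -- Choosing least values makes each choice depend only on the extension of
  -- the earlier ones, so the recursion unfolds without function extensionality.
  module TransfiniteChoice
    {T : Set ℓ} {_≺_ : Rel T ℓ} (≺-wellFounded : WellFounded _≺_)
    (V : Ordinal ℓ) (v₀ : Ordinal.Carrier V)
    (P : T → (T → Ordinal.Carrier V) → Pred (Ordinal.Carrier V) ℓ)
    (local : ∀ {t f g} → (∀ s → s ≺ t → f s ≡ g s) → P t f ⊆ P t g)
    (extend : ∀ t f → (∀ s → s ≺ t → P s f (f s)) → ∃ (P t f))
    where

    open Ordinal V using () renaming (Carrier to C)
    open WellOrder V

    private
      -- `P t` takes functions on all of `T`, so values known only below `t` are padded with `v₀`;
      -- `local` makes the padding harmless.
      total : ∀ t → (∀ {s} → s ≺ t → C) → T → C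
      total t f s with decide (s ≺ t)
      ... | yes s≺t = f s≺t
      ... | no _ = v₀

      total-cong : ∀ t {f g : ∀ {s} → s ≺ t → C} →
                   (∀ {s} (s≺t : s ≺ t) → f s≺t ≡ g s≺t) → ∀ s → total t f s ≡ total t g s
      total-cong t f≡g s with decide (s ≺ t)
      ... | yes s≺t = f≡g s≺t
      ... | no _ = refl

      total-≺ : ∀ t (f : T → C) s → s ≺ t → total t (λ {r} _ → f r) s ≡ f s
      total-≺ t f s s≺t with decide (s ≺ t)
      ... | yes _ = refl
      ... | no s⊀t = ⊥-elim (s⊀t s≺t)

      next : ∀ t → WfRec _≺_ (λ _ → C) t → C
      next t rec = leastOr v₀ (P t (total t rec))

      next-cong : ∀ t {f g : WfRec _≺_ (λ _ → C) t} →
                  (∀ {s} (s≺t : s ≺ t) → f s≺t ≡ g s≺t) → next t f ≡ next t g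
      next-cong t {f} {g} f≡g = leastOr-cong v₀
        ( local (λ s _ → total-cong t {f} {g} f≡g s)
        , local (λ s _ → sym (total-cong t {f} {g} f≡g s)))

      open FixPoint ≺-wellFounded (λ _ → C) next next-cong using (unfold-wfRec)

    abstract
      chosen : T → C
      chosen = WF.wfRec ≺-wellFounded ℓ (λ _ → C) next

      chosen-∈ : ∀ t → P t chosen (chosen t)
      chosen-∈ = WF.wfRec ≺-wellFounded ℓ (λ t → P t chosen (chosen t)) body
        where
        body : ∀ t → WfRec _≺_ (λ t → P t chosen (chosen t)) t → P t chosen (chosen t)
        -- `chosen t` is the least choice for the padded restriction of `chosen` below `t`; `local`
        -- passes between that restriction and `chosen` itself.
        body t rec = subst (P t chosen) (sym unfold-wfRec)
          (local (total-≺ t chosen)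
            (leastOr-∈ v₀ _ (map₂ (local (λ s s≺t → sym (total-≺ t chosen s s≺t)))
              (extend t chosen (λ s → rec)))))

  -- Bounds and codes in an infinite regular cardinal.

  module RegularCardinal (Λ : Ordinal ℓ) (Λ-regular : IsInfiniteRegularCardinal Λ) where
    open Ordinal Λ public
    open IsInfiniteRegularCardinal Λ-regular public
    open IsStrictTotalOrder isStrictTotalOrder public
      using (compare) renaming (trans to <-trans; irrefl to <-irrefl)

    inhabited : Carrier
    inhabited with decide Carrier
    ... | yes o = o
    ... | no none = ⊥-elim (infinite ([] , ⊥-elim ∘ none))

    -- If some `y` lies below `x`, a strict bound for the constant function `x` on the segment of
    -- `x` exceeds `x`. With nothing below or above it, `x` would be the only element.
    unbounded : ∀ x → ∃[ y ] x < y
    unbounded x with decide (∃[ y ] x < y)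
    ... | yes above = above
    ... | no maximal with decide (∃[ y ] y < x)
    ...   | yes (y , y<x) = map₂ (λ below → below y y<x) (regular x (λ _ → x))
    ...   | no minimal = ⊥-elim (infinite (x ∷ [] , λ y → here (only y)))
      where
      only : ∀ y → y ≡ x
      only y with compare y x
      ... | tri< y<x _ _ = ⊥-elim (minimal (y , y<x))
      ... | tri≈ _ y≡x _ = y≡x
      ... | tri> _ _ x<y = ⊥-elim (maximal (y , x<y))

    above-both : ∀ x y → ∃[ z ] x < z × y < z
    above-both x y with compare x y
    ... | tri< x<y _ _ = let z , y<z = unbounded y in z , <-trans x<y y<z , y<z
    ... | tri≈ _ refl _ = let z , y<z = unbounded y in z , y<z , y<z
    ... | tri> _ _ y<x = let z , x<z = unbounded x in z , x<z , <-trans y<x x<z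

    -- Regularity bounds each row, then the row bounds.
    regular₂ : ∀ a (f : Carrier → Carrier → Carrier) →
               ∃[ b ] (∀ x y → x < a → y < a → f x y < b)
    regular₂ a f = let b , row<b = regular a (λ x → proj₁ (regular a (f x))) in
      b , λ x y x<a y<a → <-trans (proj₂ (regular a (f x)) y y<a) (row<b x x<a)

    -- The Gödel ordering of pairs: its proper initial segments lie in squares
    -- a × a, so by regularity functions into Λ are bounded on them, and a
    -- strictly increasing, hence injective, map into Λ can be built by recursion.
    private
      -- A common strict upper bound takes the place of the maximum in the usual Gödel order.
      height : Carrier × Carrier → Carrier
      height (x , y) = proj₁ (above-both x y)

      key : Carrier × Carrier → Carrier × (Carrier × Carrier)
      key p = height p , p

      _⊏_ : Rel (Carrier × (Carrier × Carrier)) ℓ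
      _⊏_ = ×-Lex _≡_ _<_ (×-Lex _≡_ _<_ _<_)

      _≺_ : Rel (Carrier × Carrier) ℓ
      _≺_ = _⊏_ on key

      ≺-wellFounded : WellFounded _≺_
      ≺-wellFounded = On.wellFounded key
        (×-wellFounded wellFounded (×-wellFounded wellFounded wellFounded))

      ≺⇒<height : ∀ {p q} → p ≺ q → proj₁ p < height q × proj₂ p < height q
      ≺⇒<height {x , y} p≺q with proj₁ (above-both x y) | proj₂ (above-both x y) | p≺q
      ... | _ | x<h , y<h | inj₁ h<k = <-trans x<h h<k , <-trans y<h h<k
      ... | _ | x<h , y<h | inj₂ (refl , _) = x<h , y<h

      -- Exceeding `inhabited` reserves that element as the code of the empty list.
      IsCode : Carrier × Carrier → (Carrier × Carrier → Carrier) → Pred Carrier ℓ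
      IsCode q f v = inhabited < v × (∀ p → p ≺ q → f p < v)

      IsCode-local : ∀ {q f g} → (∀ p → p ≺ q → f p ≡ g p) → IsCode q f ⊆ IsCode q g
      IsCode-local f≡g (o<v , f<v) = o<v , λ p p≺q → subst (_< _) (f≡g p p≺q) (f<v p p≺q)

      IsCode-extend : ∀ q f → (∀ p → p ≺ q → IsCode p f (f p)) → ∃ (IsCode q f)
      IsCode-extend q f _ =
        let b , f<b = regular₂ (height q) (λ x y → f (x , y))
            v , o<v , b<v = above-both inhabited b
        in v , o<v , λ p p≺q →
             let x<h , y<h = ≺⇒<height p≺q in <-trans (f<b (proj₁ p) (proj₂ p) x<h y<h) b<v

      module Code =
        TransfiniteChoice ≺-wellFounded Λ inhabited IsCode IsCode-local IsCode-extend

    abstract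
      pair : Carrier × Carrier → Carrier
      pair = Code.chosen

      inhabited<pair : ∀ p → inhabited < pair p
      inhabited<pair p = proj₁ (Code.chosen-∈ p)

      pair-injective : ∀ {p q} → pair p ≡ pair q → p ≡ q
      pair-injective {p} {q} eq
        with ×-compare sym compare (×-compare sym compare compare) (key p) (key q)
      ... | tri< p≺q _ _ = ⊥-elim (<-irrefl eq (proj₂ (Code.chosen-∈ q) p p≺q))
      ... | tri≈ _ (_ , refl , refl) _ = refl
      ... | tri> _ _ q≺p = ⊥-elim (<-irrefl (sym eq) (proj₂ (Code.chosen-∈ p) q q≺p))

    encode : List Carrier → Carrier
    encode [] = inhabited
    encode (x ∷ xs) = pair (x , encode xs)

    encode-injective : ∀ {xs ys} → encode xs ≡ encode ys → xs ≡ ys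
    encode-injective {[]} {[]} _ = refl
    encode-injective {[]} {_ ∷ _} eq = ⊥-elim (<-irrefl eq (inhabited<pair _))
    encode-injective {_ ∷ _} {[]} eq = ⊥-elim (<-irrefl (sym eq) (inhabited<pair _))
    encode-injective {_ ∷ _} {_ ∷ _} eq =
      let eq′ = pair-injective eq in cong₂ _∷_ (cong proj₁ eq′) (encode-injective (cong proj₂ eq′))

    decode : Carrier → List Carrier
    decode z with decide (∃[ xs ] encode xs ≡ z)
    ... | yes (xs , _) = xs
    ... | no _ = []

    decode-encode : ∀ xs → decode (encode xs) ≡ xs
    decode-encode xs with decide (∃[ ys ] encode ys ≡ encode xs)
    ... | yes (_ , eq) = encode-injective eq
    ... | no none = ⊥-elim (none (xs , refl))

    -- Scattered sets meeting a filter base.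

    Disjoint : (Carrier → Pred Carrier ℓ) → Set ℓ
    Disjoint u = ∀ {i j} → i ≢ j → u i ⊥ u j

    Scattered : (Carrier → Pred Carrier ℓ) → Pred Carrier ℓ → Set ℓ
    Scattered u Y =
      (∃[ b ] (∀ i → b < i → Y ⊥ u i)) ⊎ (∀ i {x y} → Y x → Y y → u i x → u i y → x ≡ y)

    -- With nonempty members this is a filter base, indexed by `Carrier` so that a recursion along
    -- `Λ` can meet all of it.
    Directed : (Carrier → Pred Carrier ℓ) → Set ℓ
    Directed B = ∀ a b → ∃[ c ] B c ⊆ B a ∩ B b

    Meets : (Carrier → Pred Carrier ℓ) → Pred Carrier ℓ → Set ℓ
    Meets B Y = ∀ a → Satisfiable (B a ∩ Y)

    -- A `B a` that misses `∁ Q` lies inside `Q`, and then each `B b` meets `Q` in a common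
    -- refinement with `B a`.
    meets-or-meets-∁ : ∀ {B} → Directed B → (∀ a → Satisfiable (B a)) →
                       ∀ Q → Meets B Q ⊎ Meets B (∁ Q)
    meets-or-meets-∁ {B} directed nonempty Q with decide (Meets B Q)
    ... | yes meets = inj₁ meets
    ... | no ¬meets = inj₂ λ a → stable λ avoids → ¬meets λ b →
      let c , c⊆ = directed a b
          x , x∈c = nonempty c
          x∈a , x∈b = c⊆ x∈c
      in x , x∈b , stable λ x∉Q → avoids (x , x∈a , x∉Q)

    Scattered-⊆ : ∀ {u Y Z} → Z ⊆ Y → Scattered u Y → Scattered u Z
    Scattered-⊆ Z⊆Y = Sum.map
      (map₂ λ avoids i b<i (x∈Z , x∈u) → avoids i b<i (Z⊆Y x∈Z , x∈u))
      (λ thin i x∈Z y∈Z → thin i (Z⊆Y x∈Z) (Z⊆Y y∈Z))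

    -- Unless some {x : x ∉ u i for all i > b} meets the whole base, every u i can
    -- be avoided below any bound inside a member of the base, so a transversal
    -- meeting the base is chosen with strictly increasing indices.
    scatter : ∀ {u B} → Disjoint u → Directed B → (∀ a → Satisfiable (B a)) →
              ∃[ Y ] Meets B Y × Scattered u Y
    scatter {u} {B} disjoint directed nonempty
      with decide (∃[ b ] Meets B (λ x → ∀ i → b < i → ¬ u i x))
    ... | yes (b , meets) =
      (λ x → ∀ i → b < i → ¬ u i x) , meets , inj₁ (b , λ i b<i (avoids , x∈u) → avoids i b<i x∈u)
    ... | no ¬meets = Y , (λ a → point a , proj₁ (point-∈ a) , a , refl) , inj₂ thin
      where
      -- The points outside every `u i` with `b < i` miss some `B a`, which thus lies inside the
      -- union of that tail.
      high : ∀ b → ∃[ a ] (∀ x → B a x → ∃[ i ] b < i × u i x)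
      high b = stable λ none → ¬meets (b , λ a → stable λ avoids →
        none (a , λ x x∈a → stable λ low →
          avoids (x , x∈a , λ i b<i x∈u → low (i , b<i , x∈u))))

      index-unique : ∀ {i j x} → u i x → u j x → i ≡ j
      index-unique x∈uᵢ x∈uⱼ = stable λ i≢j → disjoint i≢j (x∈uᵢ , x∈uⱼ)

      -- Points in no `u j` get a default index, so that `regular` can bound `index ∘ f`.
      index : Carrier → Carrier
      index x with decide (∃[ j ] u j x)
      ... | yes (j , _) = j
      ... | no _ = inhabited

      index-≡ : ∀ {j x} → u j x → index x ≡ j
      index-≡ {j} {x} x∈u with decide (∃[ j ] u j x)
      ... | yes (_ , x∈u′) = index-unique x∈u′ x∈u
      ... | no none = ⊥-elim (none (j , x∈u))

      Next : Carrier → (Carrier → Carrier) → Pred Carrier ℓ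
      Next a f x = B a x × ∃[ i ] u i x × (∀ b → b < a → ∀ j → u j (f b) → j < i)

      Next-local : ∀ {a f g} → (∀ b → b < a → f b ≡ g b) → Next a f ⊆ Next a g
      Next-local f≡g (x∈a , i , x∈u , above) = x∈a , i , x∈u ,
        λ b b<a j y∈u → above b b<a j (subst (u j) (sym (f≡g b b<a)) y∈u)

      Next-extend : ∀ a f → (∀ b → b < a → Next b f (f b)) → ∃ (Next a f)
      Next-extend a f _ =
        -- The indices used so far are bounded by `b`; a refinement of `B a` inside the tail beyond
        -- `b` supplies a point of larger index.
        let b , f<b = regular a (index ∘ f)
            a′ , a′-high = high b
            c , c⊆ = directed a a′
            x , x∈c = nonempty c
            x∈a , x∈a′ = c⊆ x∈c
            i , b<i , x∈u = a′-high x x∈a′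
        in x , x∈a , i , x∈u ,
           λ d d<a j y∈u → <-trans (subst (_< b) (index-≡ y∈u) (f<b d d<a)) b<i

      open TransfiniteChoice wellFounded Λ inhabited Next Next-local Next-extend
        renaming (chosen to point; chosen-∈ to point-∈)

      Y : Pred Carrier ℓ
      Y x = ∃[ a ] point a ≡ x

      never-again : ∀ {a b i} → a < b → u i (point a) → ¬ u i (point b)
      never-again {a} {b} {i} a<b x∈u y∈u =
        let _ , j , y∈uⱼ , above = point-∈ b in
        <-irrefl (index-unique y∈u y∈uⱼ) (above a a<b i x∈u)

      thin : ∀ i {x y} → Y x → Y y → u i x → u i y → x ≡ y
      thin i (a , refl) (b , refl) x∈u y∈u = case compare a b of λ where
        (tri< a<b _ _) → ⊥-elim (never-again a<b x∈u y∈u)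
        (tri≈ _ a≡b _) → cong point a≡b
        (tri> _ _ b<a) → ⊥-elim (never-again b<a y∈u x∈u)

    -- First a side `R` of `Q` meeting the base is fixed. The traces `B a ∩ R` again form a filter
    -- base, and scattering relative to them keeps the result compatible with `R`.
    decide-and-scatter :
      ∀ {B} → Directed B → (∀ a → Satisfiable (B a)) → ∀ Q u →
      ∃[ Y ] Meets B Y × (Y ⊆ Q ⊎ Y ⊆ ∁ Q) × (Disjoint u → Scattered u Y)
    decide-and-scatter {B} directed nonempty Q u =
      [ (λ meets → inside meets inj₁) , (λ meets → inside meets inj₂) ]′
        (meets-or-meets-∁ directed nonempty Q)
      where
      inside : ∀ {R} → Meets B R → (∀ {Y} → Y ⊆ R → Y ⊆ Q ⊎ Y ⊆ ∁ Q) →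
               ∃[ Y ] Meets B Y × (Y ⊆ Q ⊎ Y ⊆ ∁ Q) × (Disjoint u → Scattered u Y)
      inside {R} meets decides with decide (Disjoint u)
      ... | no ¬disjoint = R , meets , decides id , λ disjoint → ⊥-elim (¬disjoint disjoint)
      ... | yes disjoint =
        let Y , Y-meets , scattered = scatter {B = λ a → B a ∩ R} disjoint
              (λ a b → let c , c⊆ = directed a b in c , λ (x∈c , x∈R) →
                 let x∈a , x∈b = c⊆ x∈c in (x∈a , x∈R) , (x∈b , x∈R))
              meets
        in Y ∩ R
         , (λ a → let x , (x∈a , x∈R) , x∈Y = Y-meets a in x , x∈a , x∈Y , x∈R)
         , decides proj₂
         , λ _ → Scattered-⊆ proj₁ scattered

  -- The recursion along the successor cardinal.

  module Construction
    (Λ : Ordinal ℓ) (Λ-regular : IsInfiniteRegularCardinal Λ)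
    (W : Ordinal ℓ) (w₀ : Ordinal.Carrier W)
    (small : ∀ w → Ordinal.segment W w ≤ᶜ Ordinal.card Λ)
    (set : Ordinal.Carrier W → Pred (Ordinal.Carrier Λ) ℓ)
    (set-surjective : ∀ (P : Pred (Ordinal.Carrier Λ) ℓ) → ∃[ w ] set w ≐ P)
    where

    open RegularCardinal Λ Λ-regular
    open Ordinal W using () renaming (Carrier to Stage; _<_ to _<ₛ_)
    module W = IsStrictTotalOrder (Ordinal.isStrictTotalOrder W)

    contains : Carrier → Pred Carrier ℓ
    contains a x = a ∈ˡ decode x

    -- Members of the filter base. `g` returns codes of sets, since the recursion needs values in a
    -- well-order.
    Meet : (Stage → Stage) → List Carrier → List Stage → Pred Carrier ℓ
    Meet g s t x = All (_∈ˡ decode x) s × All (λ η → set (g η) x) t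

    Meet-++ : ∀ {g} s t {s′ t′} → Meet g (s ++ s′) (t ++ t′) ⊆ Meet g s t ∩ Meet g s′ t′
    Meet-++ s t (in-s , in-t) =
      (All.++⁻ˡ s in-s , All.++⁻ˡ t in-t) , (All.++⁻ʳ s in-s , All.++⁻ʳ t in-t)

    -- The subset with index `ξ` is read a second time, through `pair`, as a family of subsets.
    task : Stage → Carrier → Pred Carrier ℓ
    task ξ i x = set ξ (pair (i , x))

    -- In order, the clauses keep the base proper, make the filter ultra and defeat double
    -- regularity.
    Good : Stage → (Stage → Stage) → Pred Stage ℓ
    Good ξ g v =
      (∀ s t → All (_<ₛ ξ) t → Satisfiable (Meet g s t ∩ set v)) ×
      (set v ⊆ set ξ ⊎ set v ⊆ ∁ (set ξ)) ×
      (Disjoint (task ξ) → Scattered (task ξ) (set v))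

    -- `Good` at `μ` speaks of strictly earlier stages only, so the greatest stage is split off a
    -- list and its repetitions are dropped.
    greatest : ∀ η t → ∃[ μ ] ∃[ r ] μ ∈ˡ η ∷ t × All (_<ₛ μ) r ×
                                      (∀ {ζ} → ζ ∈ˡ η ∷ t → ζ ∈ˡ μ ∷ r)
    greatest η [] = η , [] , here refl , [] , id
    greatest η (θ ∷ t) with greatest θ t
    ... | μ , r , μ∈ , r<μ , ⊆μr with W.compare η μ
    ...   | tri< η<μ _ _ = μ , η ∷ r , there μ∈ , η<μ ∷ r<μ , λ where
              (here refl) → there (here refl)
              (there ζ∈) → insert (⊆μr ζ∈)
            where
            insert : ∀ {ζ} → ζ ∈ˡ μ ∷ r → ζ ∈ˡ μ ∷ η ∷ r
            insert (here ζ≡μ) = here ζ≡μ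
            insert (there ζ∈r) = there (there ζ∈r)
    ...   | tri≈ _ refl _ = μ , r , there μ∈ , r<μ , λ where
              (here refl) → here refl
              (there ζ∈) → ⊆μr ζ∈
    ...   | tri> _ _ μ<η =
              η , μ ∷ r , here refl , μ<η ∷ All.map (λ ζ<μ → W.trans ζ<μ μ<η) r<μ , λ where
              (here refl) → here refl
              (there ζ∈) → there (⊆μr ζ∈)

    -- Without stages the point `encode s` works; otherwise goodness of the greatest stage is
    -- applied to the others.
    Meet-nonempty : ∀ {g} s t → All (λ η → Good η g (g η)) t → Satisfiable (Meet g s t)
    Meet-nonempty s [] [] =
      encode s , subst (λ r → All (_∈ˡ r) s) (sym (decode-encode s)) (All.tabulate id) , []
    Meet-nonempty s (η ∷ t) good =
      let μ , r , μ∈ , r<μ , ⊆μr = greatest η t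
          x , (in-s , in-r) , in-μ = proj₁ (All.lookup good μ∈) s r r<μ
      in x , in-s , All.tabulate (All.lookup (in-μ ∷ in-r) ∘ ⊆μr)

    module _ (ξ : Stage) where

      private
        -- Stages below `ξ` inject into `Λ`, so the base at stage `ξ` can be indexed by `Λ`.
        position : ∀ {η} → η <ₛ ξ → Carrier
        position {η} η<ξ = Injection.to (small ξ) (η , η<ξ)

        code : ∀ s {t} → All (_<ₛ ξ) t → Carrier
        code s t<ξ = pair (encode s , encode (reduce position t<ξ))

        positions-injective : ∀ {t t′} (t<ξ : All (_<ₛ ξ) t) (t′<ξ : All (_<ₛ ξ) t′) →
                              reduce position t<ξ ≡ reduce position t′<ξ → t ≡ t′
        positions-injective [] [] _ = refl
        positions-injective (_ ∷ t<ξ) (_ ∷ t′<ξ) eq =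
          cong₂ _∷_ (Injection.injective (small ξ) (∷-injectiveˡ eq))
                    (positions-injective t<ξ t′<ξ (∷-injectiveʳ eq))

        code-injective : ∀ {s s′ t t′} (t<ξ : All (_<ₛ ξ) t) (t′<ξ : All (_<ₛ ξ) t′) →
                         code s t<ξ ≡ code s′ t′<ξ → s ≡ s′ × t ≡ t′
        code-injective t<ξ t′<ξ eq = let eq′ = pair-injective eq in
          encode-injective (cong proj₁ eq′) ,
          positions-injective t<ξ t′<ξ (encode-injective (cong proj₂ eq′))

      Coded : Carrier → List Carrier → List Stage → Set ℓ
      Coded a s t = ∃[ t<ξ ] code s {t} t<ξ ≡ a

      enumerate : Carrier → ∃[ s ] ∃[ t ] All (_<ₛ ξ) t
      enumerate a with decide (∃[ s ] ∃[ t ] Coded a s t)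
      ... | yes (s , t , t<ξ , _) = s , t , t<ξ
      ... | no _ = [] , [] , []

      base : (Stage → Stage) → Carrier → Pred Carrier ℓ
      base g a = let s , t , _ = enumerate a in Meet g s t

      base-surjective : ∀ g s {t} → All (_<ₛ ξ) t → ∃[ a ] base g a ≡ Meet g s t
      base-surjective g s {t} t<ξ = code s t<ξ , found
        where
        found : base g (code s t<ξ) ≡ Meet g s t
        found with decide (∃[ s′ ] ∃[ t′ ] Coded (code s t<ξ) s′ t′)
        -- The proof `t′<ξ` found here need not be `t<ξ`, but `Meet` depends on the lists alone.
        ... | yes (_ , _ , t′<ξ , eq) =
          let s′≡s , t′≡t = code-injective t′<ξ t<ξ eq in cong₂ (Meet g) s′≡s t′≡t
        ... | no none = ⊥-elim (none (s , t , t<ξ , refl))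

      base-directed : ∀ g → Directed (base g)
      base-directed g a b =
        let s , t , t<ξ = enumerate a
            s′ , t′ , t′<ξ = enumerate b
            c , c≡ = base-surjective g (s ++ s′) (All.++⁺ t<ξ t′<ξ)
        in c , λ {x} x∈c → Meet-++ s t (subst (λ P → P x) c≡ x∈c)

    Good-local : ∀ {ξ f g} → (∀ η → η <ₛ ξ → f η ≡ g η) → Good ξ f ⊆ Good ξ g
    Good-local f≡g (meets , rest) = (λ s t t<ξ →
      let x , (in-s , in-t) , x∈v = meets s t t<ξ in
      x ,
      (in-s , All.zipWith (λ (η<ξ , x∈) → subst (λ v → set v x) (f≡g _ η<ξ) x∈) (t<ξ , in-t)) ,
      x∈v)
      , rest

    Good-extend : ∀ ξ g → (∀ η → η <ₛ ξ → Good η g (g η)) → ∃ (Good ξ g)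
    Good-extend ξ g good =
      let Y , meets , decides , scattered = decide-and-scatter (base-directed ξ g)
            (λ a → let s , t , t<ξ = enumerate ξ a in Meet-nonempty s t (All.map (good _) t<ξ))
            (set ξ) (task ξ)
          v , v⊆Y , Y⊆v = set-surjective Y
      in v
       , (λ s t t<ξ → let a , a≡ = base-surjective ξ g s t<ξ
                          x , x∈a , x∈Y = meets a
                      in x , subst (λ P → P x) a≡ x∈a , Y⊆v x∈Y)
       , Sum.map (λ Y⊆ {_} x∈v → Y⊆ (v⊆Y x∈v)) (λ Y⊆ {_} x∈v → Y⊆ (v⊆Y x∈v)) decides
       , Scattered-⊆ v⊆Y ∘ scattered

    -- The ultrafilter generated by the chosen sets.

    open TransfiniteChoice (Ordinal.wellFounded W) W w₀ Good Good-local Good-extend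

    X : Stage → Pred Carrier ℓ
    X ξ = set (chosen ξ)

    D : Pred (Pred Carrier ℓ) ℓ
    D A = ∃[ s ] ∃[ t ] Meet chosen s t ⊆ A

    consistent : ∀ s t → Satisfiable (Meet chosen s t)
    consistent s t = Meet-nonempty s t (All.universal chosen-∈ t)

    X∈D : ∀ ξ {A} → X ξ ⊆ A → A ∈ D
    X∈D ξ X⊆A = [] , ξ ∷ [] , λ { (_ , x∈X ∷ []) → X⊆A x∈X }

    -- Used to refute membership: `X ξ` can be added to the finite intersection inside `A` without
    -- emptying it.
    D-meets-X : ∀ {A} → A ∈ D → ∀ ξ → ¬ (A ⊥ X ξ)
    D-meets-X (s , t , ⊆A) ξ A⊥X =
      let _ , in-s , in-ξt = consistent s (ξ ∷ t) in
      A⊥X (⊆A (in-s , All.tail in-ξt) , All.head in-ξt)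

    isUltrafilter : IsUltrafilter Λ D
    isUltrafilter = record
      { isFilter = record
        { members  = λ _ _ → tt
        ; whole    = [] , [] , λ _ → tt
        ; upward   = λ (s , t , ⊆A) A⊆B _ → s , t , λ x∈ → A⊆B (⊆A x∈)
        ; ∩-closed = λ (s , t , ⊆A) (s′ , t′ , ⊆B) → s ++ s′ , t ++ t′ ,
            λ x∈ → let x∈st , x∈s′t′ = Meet-++ s t x∈ in ⊆A x∈st , ⊆B x∈s′t′
        ; proper   = λ (s , t , ⊆A) empty → let x , x∈ = consistent s t in empty x (⊆A x∈)
        }
      ; ultra = λ A →
          -- The stage whose task is to decide `A`.
          let ξ , ξ⊆A , A⊆ξ = set-surjective A
              _ , decides , _ = chosen-∈ ξ
          in Sum.map (λ X⊆ξ → X∈D ξ (λ x∈ → ξ⊆A (X⊆ξ x∈)))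
                     (λ X⊆∁ξ → X∈D ξ (λ x∈X x∈A → X⊆∁ξ x∈X (A⊆ξ x∈A))) decides
      }

    -- Regularity of the ultrafilter.

    F : Pred (Pred Carrier ℓ) ℓ
    -- Propositional equality of predicates would exceed level `ℓ`; `≐` does not.
    F A = ∃[ a ] A ≐ contains a

    -- The point `encode (a ∷ [])` decodes to a list whose only entry is `a`.
    contains-injective : ∀ {a b} → contains a ⊆ contains b → a ≡ b
    contains-injective {a} {b} a⊆b
      with subst (b ∈ˡ_) (decode-encode (a ∷ []))
             (a⊆b (subst (a ∈ˡ_) (sym (decode-encode (a ∷ []))) (here refl)))
    ... | here b≡a = sym b≡a

    F≈card : ⟦ F ⟧ᶠ ≈ᶜ card
    F≈card = record
      { to        = proj₁ ∘ proj₂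
      ; cong      = λ {A} {B} → to-cong A B
      ; bijective = (λ { {_ , _ , A⊆a , a⊆A} {_ , _ , B⊆a , a⊆B} refl → a⊆B ∘ A⊆a , a⊆A ∘ B⊆a })
                  , λ a → member a , λ {B} → to-cong B (member a)
      }
      where
      member : Carrier → ∃ F
      member a = contains a , a , id , id

      to-cong : ∀ (A B : ∃ F) → proj₁ A ≐ proj₁ B → proj₁ (proj₂ A) ≡ proj₁ (proj₂ B)
      to-cong (_ , _ , A⊆a , a⊆A) (_ , _ , B⊆b , b⊆B) (A⊆B , _) =
        contains-injective (λ x∈ → B⊆b (A⊆B (a⊆A x∈)))

    -- Excluded middle tells for each entry `b` whether `G` has a member equal to `contains b`; one
    -- such member per entry suffices up to `≐`.
    finitely-many : ∀ (G : Pred (Pred Carrier ℓ) ℓ) as →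
      ∃[ As ] (∀ (A : Pred Carrier ℓ) → G A → ∀ {a} → a ∈ˡ as → A ≐ contains a →
               Any (λ (B : ∃ G) → A ≐ proj₁ B) As)
    finitely-many G [] = [] , λ _ _ ()
    finitely-many G (b ∷ as) with finitely-many G as | em {∃[ B ] G B × B ≐ contains b}
    ... | As , covers | yes (B , B∈G , B⊆b , b⊆B) = (B , B∈G) ∷ As , λ where
      A A∈G (here refl) (A⊆b , b⊆A) → here (b⊆B ∘ A⊆b , b⊆A ∘ B⊆b)
      A A∈G (there a∈) A≐a → there (covers A A∈G a∈ A≐a)
    ... | As , covers | no none = As , λ where
      A A∈G (here refl) A≐b → ⊥-elim (none (A , A∈G , A≐b))
      A A∈G (there a∈) A≐a → covers A A∈G a∈ A≐a

    F-regular : IsRegularFamily F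
    F-regular = record
      { finite-⋂   = λ As As⊆F → let x , in-s , _ = consistent (reduce proj₁ As⊆F) [] in
                       x , members As⊆F in-s
      ; infinite-⋂ = λ G G⊆F infinite x x∈⋂ →
          -- Every member of `G` contains `x`, hence is `contains a` for some entry `a` of the
          -- finite list `decode x`.
          let As , covers = finitely-many G (decode x) in
          infinite (As , λ (A , A∈G) → let a , A⊆a , a⊆A = G⊆F A∈G in
            covers A A∈G (A⊆a (x∈⋂ A A∈G)) (A⊆a , a⊆A))
      }
      where
      members : ∀ {As x} (As⊆F : All F As) → All (_∈ˡ decode x) (reduce proj₁ As⊆F) →
                All (λ A → A x) As
      members [] [] = []
      members ((_ , _ , a⊆A) ∷ As⊆F) (a∈ ∷ rest) = a⊆A a∈ ∷ members As⊆F rest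

    D-regular : Regular card D
    D-regular = F , F-regular , F≈card ,
      λ (a , _ , a⊆A) → a ∷ [] , [] , λ { (a∈ ∷ [] , _) → a⊆A a∈ }

    -- Failure of double regularity.

    regular-avoids-point :
      ∀ {V E} → IsFilter V E → Regular card E → ∀ {Y : Pred Carrier ℓ} →
      (∀ {x y} → Y x → Y y → V x → V y → x ≡ y) → ∃[ A ] A ∈ E × A ⊥ Y
    regular-avoids-point {V} {E} filter (H , H-regular , H≈card , H⊆E) {Y} thin =
      -- Otherwise each member of `H` meets `Y` inside `V`, always in the same point `x`. Then `x`
      -- lies in all of `H`, which is infinite because it maps onto `Λ`.
      decidable-stable em λ none →
      let open IsFilter filter
          open Bijection H≈card using (surjection; to)
          meets : ∀ {A} → A ∈ H → Satisfiable (A ∩ Y)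
          meets A∈H = stable λ avoids → none (_ , H⊆E A∈H , λ {x} x∈ → avoids (x , x∈))
          (A , A∈H) = Surjection.to⁻ surjection inhabited
          x , x∈A , x∈Y = meets A∈H
      in IsRegularFamily.infinite-⋂ H-regular H id
           (λ (As , enumerates) → infinite (_ , Enumerates.map⁺ _ card surjection enumerates))
           x (λ B B∈H → let y , y∈B , y∈Y = meets B∈H in
              subst B (thin y∈Y x∈Y (members (H⊆E B∈H) y∈B) (members (H⊆E A∈H) x∈A)) y∈B)

    D-not-doublyRegular : ¬ DoublyRegular Λ D
    D-not-doublyRegular doublyRegular =
      -- The stage whose index codes the whole family `u` as one subset of `Λ`.
      let ξ , ξ⊆ , ⊆ξ = set-surjective (λ z → ∃[ i ] ∃[ x ] pair (i , x) ≡ z × u i x)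
          task⊆u : ∀ {i} → task ξ i ⊆ u i
          task⊆u x∈ = decoded (ξ⊆ x∈)
          u⊆task : ∀ {i} → u i ⊆ task ξ i
          u⊆task x∈ = ⊆ξ (_ , _ , refl , x∈)
          _ , _ , scattered = chosen-∈ ξ
      in [ (λ (b , avoids) →
              D-meets-X (reflects (λ x → ∃[ i ] b < i × u i x)
                (b , λ i b<i → IsFilter.upward (isFilter i) (IsFilter.whole (isFilter i))
                   (λ x∈u → (i , b<i , x∈u) , x∈u) proj₂))
                ξ (λ ((i , b<i , x∈u) , x∈X) → avoids i b<i (x∈X , u⊆task x∈u)))
         , (λ thin →
              let small-sets i = regular-avoids-point (isFilter i) (DR.regular i)
                    (λ x∈X y∈X x∈u y∈u → thin i x∈X y∈X (u⊆task x∈u) (u⊆task y∈u))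
              in D-meets-X (reflects (λ x → ∃[ i ] proj₁ (small-sets i) x)
                   -- The bound is arbitrary, as every index satisfies the condition.
                   (inhabited , λ i _ → let A , A∈ , _ = small-sets i in
                     IsFilter.upward (isFilter i) A∈
                       (λ x∈A → (i , x∈A) , IsFilter.members (isFilter i) A∈ x∈A) proj₂))
                   ξ (λ ((i , x∈A) , x∈X) → proj₂ (proj₂ (small-sets i)) (x∈A , x∈X)))
         ]′ (scattered λ i≢j (x∈i , x∈j) → disjoint i≢j (task⊆u x∈i , task⊆u x∈j))
      where
      module DR = DoublyRegular doublyRegular
      open DR using (u; disjoint; isFilter; reflects)

      decoded : ∀ {i x} → (∃[ j ] ∃[ y ] pair (j , y) ≡ pair (i , x) × u j y) → u i x
      decoded (_ , _ , eq , y∈u) = subst (λ (i , x) → u i x) (pair-injective eq) y∈u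

theorem7 : ∀ {ℓ : Level} → ExcludedMiddle (suc ℓ) →
    (Λ : Ordinal ℓ) → IsInfiniteRegularCardinal Λ → 2^Λ≡Λ⁺ Λ →
    ∃[ D ] IsUltrafilter Λ D × Regular (Ordinal.card Λ) D × ¬ DoublyRegular Λ D
theorem7 {ℓ} em Λ Λ-regular (Λ⁺ , (_ , small) , 2^Λ≈Λ⁺) =
  D , isUltrafilter , D-regular , D-not-doublyRegular
  where
  open Classical em
  open Ordinal Λ using (Carrier)
  open Bijection 2^Λ≈Λ⁺ using (to; injective; strictlySurjective)

  set : Ordinal.Carrier Λ⁺ → Pred Carrier ℓ
  set w x = Lift ℓ (proj₁ (strictlySurjective w) x ≡ true)

  set-surjective : ∀ P → ∃[ w ] set w ≐ P
  set-surjective P = to χ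
    , (λ {x} (lift eq) → from-true (decide (P x)) (trans (sym (χ-code x)) eq))
    , (λ {x} x∈P → lift (trans (χ-code x) (dec-true (decide (P x)) x∈P)))
    where
    χ : Carrier → Bool
    χ x = does (decide (P x))

    -- The preimage picked for `to χ` need not be `χ` itself; injectivity gives pointwise agreement.
    χ-code : ∀ x → proj₁ (strictlySurjective (to χ)) x ≡ χ x
    χ-code = injective (proj₂ (strictlySurjective (to χ)))

    from-true : ∀ {A : Set ℓ} (A? : Dec A) → does A? ≡ true → A
    from-true (yes a) _ = a

  -- Any element of `Λ⁺` would do as the default value.
  open Construction Λ Λ-regular Λ⁺ (to (λ _ → false)) small set set-surjective
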